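{- For each $\ell\geq 3$ there are infinitely many $4$-critical graphs of odd-girth $>\ell$, forming a family of quadratic edge density; in particular $c_{\ell,4}\geq \frac{1}{(\ell+1)^2}$.
   Context: A graph is $k$-critical if it has chromatic number $k$ and removing any edge allows it to be properly $(k-1)$-colored. The odd-girth of a graph is the length of a shortest odd cycle. For integers $\ell\geq 3$, $k\geq 4$, the density constant $c_{\ell,k}$ is the supremum of the constants $c$ such that there are infinitely many $k$-critical graphs of odd-girth $>\ell$, each having more than $cn^2$ edges, where $n$ is its number of vertices. -}

module Defs where

open import Data.Bool using (Bool; false; T; not; _∧_; _∨_)
open import Data.Bool.Properties using (T?; ∧-comm; ∨-comm)
open import Data.Fin using (Fin; toℕ; _<?_; _≟_)
open import Data.Integer using (+_)
open import Data.List using (List; length; filter; allFin; cartesianProduct)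
open import Data.Nat using (ℕ; suc; _*_; _∸_; _≤_; _<_)
open import Data.Nat.Divisibility using (_∣_)
open import Data.Product using (Σ; ∃; _×_; _,_)
open import Data.Rational as ℚ using (ℚ; 0ℚ)
open import Data.Rational.Properties using (<-trans; <-dense)
open import Function.Bundles using (_↔_; Inverse)
open import Function.Definitions using (Injective)
open import Relation.Binary.PropositionalEquality
  using (_≡_; _≢_; trans; cong; cong₂)
open import Relation.Nullary using (¬_)
open import Relation.Nullary.Decidable using (⌊_⌋; _×-dec_)

-- Finite simple graphs, with vertex set Fin order.
record Graph : Set where
  field
    order   : ℕ
    adj     : Fin order → Fin order → Bool
    adj-sym : ∀ u v → adj u v ≡ adj v u
    no-loop : ∀ v → adj v v ≡ false

  Vertex : Set
  Vertex = Fin order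

  Adj : Vertex → Vertex → Set
  Adj u v = T (adj u v)

  -- Each edge is listed once, with its smaller endpoint first.
  edges : List (Vertex × Vertex)
  edges = filter (λ (u , v) → (u <? v) ×-dec T? (adj u v))
                 (cartesianProduct (allFin order) (allFin order))

  size : ℕ
  size = length edges

open Graph

record _≅_ (G H : Graph) : Set where
  field
    bijection : Vertex G ↔ Vertex H
    preserves : ∀ u v → adj G u v ≡ adj H (Inverse.to bijection u) (Inverse.to bijection v)

module _ {n : ℕ} where

  samePair : (u v x y : Fin n) → Bool
  samePair u v x y = (⌊ x ≟ u ⌋ ∧ ⌊ y ≟ v ⌋) ∨ (⌊ x ≟ v ⌋ ∧ ⌊ y ≟ u ⌋)

  samePair-sym : ∀ u v x y → samePair u v x y ≡ samePair u v y x
  samePair-sym u v x y = trans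
    (∨-comm (⌊ x ≟ u ⌋ ∧ ⌊ y ≟ v ⌋) (⌊ x ≟ v ⌋ ∧ ⌊ y ≟ u ⌋))
    (cong₂ _∨_ (∧-comm ⌊ x ≟ v ⌋ ⌊ y ≟ u ⌋) (∧-comm ⌊ x ≟ u ⌋ ⌊ y ≟ v ⌋))

removeEdge : (G : Graph) → Vertex G → Vertex G → Graph
removeEdge G u v = record
  { order   = order G
  ; adj     = λ x y → adj G x y ∧ not (samePair u v x y)
  ; adj-sym = λ x y → cong₂ (λ a b → a ∧ not b) (adj-sym G x y) (samePair-sym u v x y)
  ; no-loop = λ x → cong (_∧ not (samePair u v x x)) (no-loop G x)
  }

Colourable : Graph → ℕ → Set
Colourable G k = Σ (Vertex G → Fin k) λ colour →
  ∀ u v → Adj G u v → colour u ≢ colour v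

HasChromaticNumber : Graph → ℕ → Set
HasChromaticNumber G k = Colourable G k × (∀ j → Colourable G j → k ≤ j)

Critical : ℕ → Graph → Set
Critical k G = HasChromaticNumber G k ×
  (∀ u v → Adj G u v → Colourable (removeEdge G u v) (k ∸ 1))

record Cycle (G : Graph) (m : ℕ) : Set where
  field
    length≥3  : 3 ≤ m
    vertex    : Fin m → Vertex G
    injective : Injective _≡_ _≡_ vertex
    step      : ∀ i j → toℕ j ≡ suc (toℕ i) → Adj G (vertex i) (vertex j)
    close     : ∀ i j → suc (toℕ i) ≡ m → toℕ j ≡ 0 → Adj G (vertex i) (vertex j)

OddCycle : Graph → ℕ → Set
OddCycle G m = ¬ (2 ∣ m) × Cycle G m

IsOddGirth : Graph → ℕ → Set
IsOddGirth G g = OddCycle G g × (∀ m → OddCycle G m → g ≤ m)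

-- Bipartite graphs have no odd girth and are excluded; k-critical graphs
-- with k ≥ 3 are never bipartite.
OddGirthAbove : ℕ → Graph → Set
OddGirthAbove ℓ G = ∃ λ g → IsOddGirth G g × ℓ < g

PairwiseNonIsomorphic : (ℕ → Graph) → Set
PairwiseNonIsomorphic G = ∀ i j → G i ≅ G j → i ≡ j

InfinitelyMany : (Graph → Set) → Set
InfinitelyMany P = Σ (ℕ → Graph) λ G → PairwiseNonIsomorphic G × (∀ i → P (G i))

fromℕ : ℕ → ℚ
fromℕ n = + n ℚ./ 1

DenserThan : ℚ → Graph → Set
DenserThan c G = c ℚ.* fromℕ (order G * order G) ℚ.< fromℕ (size G)

QuadraticEdgeDensity : (ℕ → Graph) → Set
QuadraticEdgeDensity G = ∃ λ c → 0ℚ ℚ.< c × (∀ i → DenserThan c (G i))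

-- Extended lower reals: x is represented by the set of rationals below it.
record LowerReal : Set₁ where
  field
    below   : ℚ → Set
    closed  : ∀ {q r} → q ℚ.< r → below r → below q
    rounded : ∀ {q} → below q → ∃ λ r → q ℚ.< r × below r

open LowerReal

_≤ᴸ_ : LowerReal → LowerReal → Set
x ≤ᴸ y = ∀ q → below x q → below y q

fromℚ : ℚ → LowerReal
fromℚ p = record
  { below   = ℚ._< p
  ; closed  = <-trans
  ; rounded = λ q<p → let (r , q<r , r<p) = <-dense q<p in r , q<r , r<p
  }

sup : (ℚ → Set) → LowerReal
sup S = record
  { below   = λ q → ∃ λ c → S c × q ℚ.< c
  ; closed  = λ q<r (c , c∈S , r<c) → c , c∈S , <-trans q<r r<c
  ; rounded = λ (c , c∈S , q<c) →
      let (r , q<r , r<c) = <-dense q<c in r , q<r , (c , c∈S , r<c)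
  }

-- It suffices to let c range over ℚ: the set of admissible real c is closed
-- downwards, so its rational members have the same supremum.
densityConstant : (ℓ k : ℕ) → LowerReal
densityConstant ℓ k = sup λ c →
  InfinitelyMany λ G → Critical k G × OddGirthAbove ℓ G × DenserThan c G

{-# OPTIONS --safe #-}

-- A half of the graph consists of an odd cycle C of length s (row 0), further
-- rows 1, …, h of s vertices each, consecutive rows being joined as in the
-- generalised Mycielski construction (column c to the columns c ± 1), and an
-- independent row h + 1 matched to row h.  The graph is made of two halves
-- with all edges between their last rows.
--
-- In a 3-colouring one of the two last rows would be monochromatic, so that
-- row h of that half would avoid a colour.  Zigzag walks between consecutive
-- rows all have the same winding number around the triangle of colours: it is
-- twice that of C, hence nonzero because C is odd, but it vanishes for the
-- zigzag between row h and a constant row.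
--
-- Without an edge at a last row, colour the columns alternately except for
-- one.  Without an edge between two columns, colour alternately around
-- that cut, and use the third colour on every other vertex of the path formed
-- by the edges across the cut.
--
-- An odd closed walk uses an edge of one of the odd cycles.  If it has length
-- at most 2h + 3 < s, it is too short to leave the half of that edge, and it
-- misses a column; but a half without a column is bipartite.

module Submission where

open import Defs
open import Algebra.Properties.CommutativeSemigroup using (interchange)
open import Data.Bool using (Bool; true; false; not; _xor_; _∧_; _∨_; T; if_then_else_)
open import Data.Bool.Properties
  using (not-involutive; not-¬; not-injective; not-distribˡ-xor; not-distribʳ-xor;
         ∧-zeroʳ; ∨-comm; T-∨; T-∧; T?)
open import Data.Fin as Fin
  using (Fin; toℕ; inject₁; inject≤; fromℕ<; combine; remQuot; finToFun; funToFin)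
open import Data.Fin.Patterns using (0F; 1F; 2F; 3F)
open import Data.Fin.Permutation using (↔⇒≡)
open import Data.Fin.Properties as Fin using (all?; any?)
import Data.Integer as ℤ
import Data.Integer.Properties as ℤ
open import Data.List using (lookup)
open import Data.List.Membership.Propositional using (_∈_)
open import Data.List.Membership.Propositional.Properties
  using (∈-filter⁺; ∈-cartesianProduct⁺; ∈-allFin)
open import Data.List.Relation.Unary.Any using (index)
open import Data.List.Relation.Unary.Any.Properties using (lookup-index)
open import Data.Nat as ℕ hiding (_/_)
open import Data.Nat.DivMod hiding (_/_)
open import Data.Nat.Divisibility using (_∣_; divides; _∣?_)
open import Data.Nat.Induction using (<-rec)
open import Data.Nat.Properties
open import Data.Nat.Tactic.RingSolver using (solve-∀)
open import Data.Product using (Σ; ∃; _×_; _,_; proj₁; proj₂; map₂)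
open import Data.Product.Properties using (,-injectiveˡ; ,-injectiveʳ)
open import Data.Rational as ℚ using (_/_)
import Data.Rational.Properties as ℚ
import Data.Rational.Unnormalised as ℚᵘ
import Data.Rational.Unnormalised.Properties as ℚᵘ
open import Data.Sum as Sum using (_⊎_; inj₁; inj₂; swap)
open import Function using (_∘_)
open import Function.Bundles using (Equivalence)
open import Relation.Binary.PropositionalEquality
open import Relation.Nullary using (¬_; Dec; yes; no; does; contradiction)
open import Relation.Nullary.Decidable
  using (from-yes; _→-dec_; ¬?; map′; _×-dec_; _⊎-dec_; dec-true; dec-false;
         ⌊_⌋; toWitness; fromWitness)

open Graph

-- Parity.

odd : ℕ → Bool
odd zero    = false
odd (suc n) = not (odd n)

odd-+-self : ∀ n → odd (n + n) ≡ false
odd-+-self zero    = refl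
odd-+-self (suc n) = trans (cong (not ∘ odd) (+-suc n n))
  (trans (not-involutive _) (odd-+-self n))

2∣⇒¬odd : ∀ {n} → 2 ∣ n → odd n ≡ false
2∣⇒¬odd (divides zero    refl) = refl
2∣⇒¬odd (divides (suc q) refl) = trans (not-involutive _) (2∣⇒¬odd (divides q refl))

¬odd⇒double : ∀ n → odd n ≡ false → ∃ λ q → n ≡ q + q
odd⇒1+double : ∀ n → odd n ≡ true → ∃ λ q → n ≡ suc (q + q)

¬odd⇒double zero    _ = 0 , refl
¬odd⇒double (suc n) p with odd⇒1+double n (not-injective p)
... | q , refl = suc q , cong suc (sym (+-suc q q))

odd⇒1+double (suc n) p with ¬odd⇒double n (not-injective p)
... | q , refl = q , refl

¬odd⇒2∣ : ∀ n → odd n ≡ false → 2 ∣ n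
¬odd⇒2∣ n p with ¬odd⇒double n p
... | q , refl = divides q (sym (trans (*-comm q 2) (cong (q +_) (+-identityʳ q))))

flips⇒odd : (κ : ℕ → Bool) → ∀ n → (∀ t → t < n → κ (suc t) ≡ not (κ t)) →
  κ n ≡ odd n xor κ 0
flips⇒odd κ zero    f = refl
flips⇒odd κ (suc n) f = trans (f n ≤-refl)
  (trans (cong not (flips⇒odd κ n λ t t<n → f t (m<n⇒m<1+n t<n)))
         (not-distribˡ-xor (odd n) (κ 0)))

-- Finite sums and winding numbers of 3-coloured rows.

sum< : ℕ → (ℕ → ℕ) → ℕ
sum< zero    f = 0
sum< (suc n) f = f n + sum< n f

sum<-cong : ∀ n {f g} → (∀ i → f i ≡ g i) → sum< n f ≡ sum< n g
sum<-cong zero    eq = refl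
sum<-cong (suc n) eq = cong₂ _+_ (eq n) (sum<-cong n eq)

sum<-+ : ∀ n f g → sum< n (λ i → f i + g i) ≡ sum< n f + sum< n g
sum<-+ zero    f g = refl
sum<-+ (suc n) f g = trans (cong (f n + g n +_) (sum<-+ n f g))
  (interchange +-commutativeSemigroup (f n) (g n) (sum< n f) (sum< n g))

sum<-const-1 : ∀ n → sum< n (λ _ → 1) ≡ n
sum<-const-1 zero    = refl
sum<-const-1 (suc n) = cong suc (sum<-const-1 n)

sum<-suc : ∀ n f → sum< n (f ∘ suc) + f 0 ≡ f n + sum< n f
sum<-suc zero    f = +-comm 0 (f 0)
sum<-suc (suc n) f = trans (+-assoc (f (suc n)) (sum< n (f ∘ suc)) (f 0))
  (cong (f (suc n) +_) (sum<-suc n f))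

sum<-shift : ∀ n f → f n ≡ f 0 → sum< n (f ∘ suc) ≡ sum< n f
sum<-shift n f eq = +-cancelʳ-≡ (f 0) _ _
  (trans (sum<-suc n f) (trans (cong (_+ sum< n f) eq) (+-comm (f 0) (sum< n f))))

-- On an edge of a 3-colouring the colour goes up or down by 1 modulo 3; this
-- is the indicator of going up.  A closed walk of length m with r rises has
-- winding number (2r − m) / 3, so that counting rises avoids integers.
rise : Fin 3 → Fin 3 → ℕ
rise 0F 1F = 1
rise 1F 2F = 1
rise 2F 0F = 1
rise _  _  = 0

-- A closed walk of length 4 on the triangle of colours has winding number 0, hence 2 rises;
-- reversing its second half turns this into the equation.
rise-face : ∀ a b c d → a ≢ b → b ≢ c → a ≢ d → d ≢ c →
  rise a b + rise b c ≡ rise a d + rise d c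
rise-face = from-yes (all? λ a → all? λ b → all? λ c → all? λ d →
  ¬? (a Fin.≟ b) →-dec ¬? (b Fin.≟ c) →-dec ¬? (a Fin.≟ d) →-dec ¬? (d Fin.≟ c) →-dec
  (rise a b + rise b c ≟ rise a d + rise d c))

rise-swap : ∀ a b → a ≢ b → rise a b + rise b a ≡ 1
rise-swap = from-yes (all? λ a → all? λ b →
  ¬? (a Fin.≟ b) →-dec (rise a b + rise b a ≟ 1))

third-colour : ∀ (x y a b : Fin 3) → x ≢ y → a ≢ x → a ≢ y → b ≢ x → b ≢ y → a ≡ b
third-colour = from-yes (all? {3} λ x → all? {3} λ y → all? {3} λ a → all? {3} λ b →
  ¬? (x Fin.≟ y) →-dec ¬? (a Fin.≟ x) →-dec ¬? (a Fin.≟ y) →-dec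
  ¬? (b Fin.≟ x) →-dec ¬? (b Fin.≟ y) →-dec (a Fin.≟ b))

module Winding (s : ℕ) where

  Row : Set
  Row = ℕ → Fin 3

  Periodic : Row → Set
  Periodic a = ∀ i → a (i + s) ≡ a i

  Apart : Row → Row → Set
  Apart a b = (∀ i → a i ≢ b (suc i)) × (∀ i → b i ≢ a (suc i))

  rises : Row → Row → ℕ
  rises a b = sum< s λ i → rise (a i) (b (suc i))

  -- The walk a 0, b 1, a 2, … closes up after 2s steps, since s is odd.
  zigzag : Row → Row → ℕ
  zigzag a b = rises a b + rises b a

  rises-shift : ∀ {a b} → Periodic a → Periodic b →
    sum< s (λ i → rise (a (suc i)) (b (suc (suc i)))) ≡ rises a b
  rises-shift pa pb =
    sum<-shift s _ (cong₂ rise (pa 0) (pb 1))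

  -- The squares `b i`, `a (suc i)`, `b (suc (suc i))`, `c (suc i)` fill the strip between the two
  -- zigzags. By `rise-face` either way around a square has the same rises, and summing over `i`
  -- gives the two zigzags up to a cyclic shift.
  zigzag-step : ∀ {a b c} → Periodic a → Periodic b → Periodic c →
    Apart a b → Apart b c → zigzag a b ≡ zigzag b c
  zigzag-step {a} {b} {c} pa pb pc (ab , ba) (bc , cb) = begin
    rises a b + rises b a  ≡⟨ +-comm (rises a b) _ ⟩
    rises b a + rises a b  ≡⟨ cong (rises b a +_) (rises-shift pa pb) ⟨
    rises b a + sum< s _   ≡⟨ sum<-+ s _ _ ⟨
    sum< s _               ≡⟨ sum<-cong s (λ i →
      rise-face (b i) (a (suc i)) (b (suc (suc i))) (c (suc i))
        (ba i) (ab (suc i)) (bc i) (cb (suc i))) ⟩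
    sum< s _               ≡⟨ sum<-+ s _ _ ⟩
    rises b c + sum< s _   ≡⟨ cong (rises b c +_) (rises-shift pc pb) ⟩
    rises b c + rises c b  ∎
    where open ≡-Reasoning

  -- Each step from a colour `a i` to `x` is matched by the step back, and each such pair contains
  -- one rise: s rises in 2s steps, that is, winding number 0.
  zigzag-const : ∀ {a x} → Periodic a → (∀ i → a i ≢ x) → zigzag a (λ _ → x) ≡ s
  zigzag-const {a} {x} pa a≢x = begin
    rises a (λ _ → x) + rises (λ _ → x) a
      ≡⟨ cong (rises a (λ _ → x) +_) (sum<-shift s (rise x ∘ a) (cong (rise x) (pa 0))) ⟩
    rises a (λ _ → x) + sum< s (rise x ∘ a)
                           ≡⟨ sum<-+ s _ _ ⟨
    sum< s _               ≡⟨ sum<-cong s (λ i → rise-swap (a i) x (a≢x i)) ⟩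
    sum< s _               ≡⟨ sum<-const-1 s ⟩
    s                      ∎
    where open ≡-Reasoning

  -- Parity replaces the winding number here: the zigzag of row 0 with itself counts every rise
  -- twice, whereas next to a constant row the count would be the odd number `s`.
  no-constant-row : odd s ≡ true → ∀ h (a : ℕ → Row) (x : Fin 3) → (∀ j → Periodic (a j)) →
    Apart (a 0) (a 0) → (∀ j → j < h → Apart (a j) (a (suc j))) → ¬ (∀ i → a h i ≢ x)
  no-constant-row s-odd h a x per base layer avoid =
    contradiction (trans (sym s-odd) (trans (cong odd s≡) (odd-+-self (rises (a 0) (a 0))))) λ ()
    where
    -- `b` is left general because it is the constant row at the top and `a (suc j)` in the
    -- recursive calls.
    descend : ∀ j → j ≤ h → ∀ b → Periodic b → Apart (a j) b → zigzag (a j) b ≡ zigzag (a 0) (a 0)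
    descend zero    _   b pb ab = sym (zigzag-step (per 0) (per 0) pb base ab)
    descend (suc j) j<h b pb ab = trans
      (sym (zigzag-step (per j) (per (suc j)) pb (layer j j<h) ab))
      (descend j (<⇒≤ j<h) (a (suc j)) (per (suc j)) (layer j j<h))

    s≡ : s ≡ zigzag (a 0) (a 0)
    s≡ = trans (sym (zigzag-const (per h) avoid))
      (descend h ≤-refl (λ _ → x) (λ _ → refl) ((λ i → avoid i) , λ i x≡ → avoid (suc i) (sym x≡)))

-- The cycle of columns, steps between rows, and marks along a cut.

-- The edges of the cycle 0, …, L; since its length is odd, L is even.
data Next (L : ℕ) : ℕ → ℕ → Set where
  next : ∀ {c} → c < L → Next L c (suc c)
  wrap : Next L L 0

next? : ∀ L c d → Dec (Next L c d)
next? L c zero    = map′ (λ { refl → wrap }) (λ { wrap → refl }) (c ≟ L)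
next? L c (suc d) = map′ (λ { (refl , c<L) → next c<L }) (λ { (next c<L) → refl , c<L })
  (c ≟ d ×-dec c <? L)

next-≤ʳ : ∀ {L c d} → Next L c d → d ≤ L
next-≤ʳ (next c<L) = c<L
next-≤ʳ wrap       = z≤n

next-irrefl : ∀ {L c} → 0 < L → ¬ Next L c c
next-irrefl () wrap

next-asym : ∀ {L c d} → 1 < L → Next L c d → ¬ Next L d c
next-asym (s≤s ()) (next c<L) wrap
next-asym (s≤s ()) wrap (next _)

next-injective : ∀ {L c c′ d} → Next L c d → Next L c′ d → c ≡ c′
next-injective (next _) (next _) = refl
next-injective wrap     wrap     = refl

<ᵇ-suc : ∀ {c i} → suc c ≢ i → (suc c <ᵇ i) ≡ (c <ᵇ i)
<ᵇ-suc {c} {i} ≢i with c <? i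
... | yes c<i = trans (dec-true (suc c <? i) (≤∧≢⇒< c<i ≢i)) (sym (dec-true (c <? i) c<i))
... | no  c≮i = trans (dec-false (suc c <? i) (c≮i ∘ <-trans (n<1+n c)))
                      (sym (dec-false (c <? i) c≮i))

-- Around the odd cycle 0, …, L this alternates along every edge but the one
-- entering i.
alternating : ℕ → ℕ → Bool
alternating i c = odd c xor (c <ᵇ i)

alternating-next : ∀ {L i c d} → odd L ≡ false → i ≤ L → Next L c d → d ≢ i →
  alternating i d ≡ not (alternating i c)
alternating-next {i = i} _ _ (next {c} _) d≢i =
  trans (cong (not (odd c) xor_) (<ᵇ-suc d≢i)) (sym (not-distribˡ-xor (odd c) _))
alternating-next {L} {i} even i≤L wrap 0≢i = trans
  (dec-true (0 <? i) (n≢0⇒n>0 (0≢i ∘ sym)))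
  (sym (cong not (cong₂ _xor_ even (dec-false (L <? i) (≤⇒≯ i≤L)))))

data RowStep : ℕ → ℕ → Set where
  flat : RowStep 0 0
  up   : ∀ {j} → RowStep j (suc j)
  down : ∀ {j} → RowStep (suc j) j

rowStep? : ∀ j k → Dec (RowStep j k)
rowStep? j k = map′ to from ((k ≟ suc j ⊎-dec j ≟ suc k) ⊎-dec (j ≟ 0 ×-dec k ≟ 0))
  where
  to : (k ≡ suc j ⊎ j ≡ suc k) ⊎ (j ≡ 0 × k ≡ 0) → RowStep j k
  to (inj₁ (inj₁ refl))   = up
  to (inj₁ (inj₂ refl))   = down
  to (inj₂ (refl , refl)) = flat

  from : RowStep j k → (k ≡ suc j ⊎ j ≡ suc k) ⊎ (j ≡ 0 × k ≡ 0)
  from flat = inj₂ (refl , refl)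
  from up   = inj₁ (inj₁ refl)
  from down = inj₁ (inj₂ refl)

-- The row of the upper end of an oblique step; in `marked` only rows below it, on the arm of the
-- path containing the step, are switched. A flat step needs no switch: the two arms already carry
-- equal marks at row 0.
cap : ∀ {j k} → RowStep j k → ℕ
cap flat         = 0
cap (up {j})     = suc j
cap (down {j})   = suc j

cap≤ : ∀ {h j k} (e : RowStep j k) → j ≤ h → k ≤ h → cap e ≤ h
cap≤ flat _ _ = z≤n
cap≤ up   _ q = q
cap≤ down p _ = p

-- The edges between two consecutive columns form a path through all the
-- vertices of both, with its ends in row h.  Once the edge e is removed from
-- it, the marked vertices are every other vertex of either part, avoiding
-- the ends; b tells the target column of e from its source.
marked : ∀ {j k} → ℕ → RowStep j k → Bool → ℕ → Bool
marked {j} h e b y = odd (h + y) xor (not ((b xor odd y) xor odd j) ∧ (y <ᵇ cap e))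

marked-top : ∀ {h j k} (e : RowStep j k) → j ≤ h → k ≤ h → ∀ b → marked h e b h ≡ false
marked-top {h} {j} e j≤h k≤h b = trans
  (cong₂ (λ p q → p xor (not ((b xor odd h) xor odd j) ∧ q)) (odd-+-self h)
    (dec-false (h <? cap e) (≤⇒≯ (cap≤ e j≤h k≤h))))
  (∧-zeroʳ _)

<ᵇ-gap : ∀ {y n} → (y <ᵇ n) ≢ (suc y <ᵇ n) → n ≡ suc y
<ᵇ-gap {y} {n} ne with n ≟ suc y
... | yes n≡ = n≡
... | no  n≢ = contradiction (sym (<ᵇ-suc (n≢ ∘ sym))) ne

xor-cancelˡ-not : ∀ a p q → a xor p ≡ not a xor q → p ≡ not q
xor-cancelˡ-not false p q eq = eq
xor-cancelˡ-not true  p q eq = sym (trans (cong not (sym eq)) (not-involutive p))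

∧-gap : ∀ a p q → a ∧ p ≡ not (a ∧ q) → a ≡ true × p ≢ q
∧-gap true p q eq = refl , λ p≡q → not-¬ {q} refl (trans (sym p≡q) eq)

not-xor⇒≡ : ∀ {a b} → not (a xor b) ≡ true → a ≡ b
not-xor⇒≡ {true}  {true}  _ = refl
not-xor⇒≡ {false} {false} _ = refl

module _ (h : ℕ) {j k : ℕ} (e : RowStep j k) where

  -- One row up, the parity term of `marked` changes, so equal marks force the switching term to
  -- change too. That happens only on the arm of `e`, at its upper end. Here the upper vertex lies
  -- in the target column, in `gap′` in the source column.
  gap : ∀ {y} → marked h e false y ≡ marked h e true (suc y) → odd y ≡ odd j × cap e ≡ suc y
  gap {y} eq rewrite +-suc h y | not-involutive (odd y) =
    let (a , ne) = ∧-gap (not (odd y xor odd j)) _ _ (xor-cancelˡ-not (odd (h + y)) _ _ eq)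
    in not-xor⇒≡ a , <ᵇ-gap ne

  gap′ : ∀ {y} → marked h e true y ≡ marked h e false (suc y) → not (odd y) ≡ odd j × cap e ≡ suc y
  gap′ {y} eq rewrite +-suc h y =
    let (a , ne) = ∧-gap (not (not (odd y) xor odd j)) _ _ (xor-cancelˡ-not (odd (h + y)) _ _ eq)
    in not-xor⇒≡ a , <ᵇ-gap ne

-- An oblique `e` lies on exactly one of the two arms meeting at the flat edge, and only that arm is
-- switched at row 0.
flat-gap : ∀ a b → a xor (not b ∧ true) ≢ a xor (not (not b) ∧ true)
flat-gap false false ()
flat-gap false true  ()
flat-gap true  false ()
flat-gap true  true  ()

-- Marks alternate along the path except at `e`. An oblique step between the same rows as `e` but in
-- the opposite direction lies on the other arm, which the parity from `gap` or `gap′` rules out.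
marked-clash : ∀ h {j k} (e : RowStep j k) {y z} → RowStep y z →
  marked h e false y ≡ marked h e true z → y ≡ j × z ≡ k
marked-clash h flat     flat     eq = refl , refl
marked-clash h up       flat     eq = contradiction eq (flat-gap (odd (h + 0)) _)
marked-clash h down     flat     eq = contradiction eq (flat-gap (odd (h + 0)) _)
marked-clash h flat     up       eq = contradiction (proj₂ (gap h flat eq)) λ ()
marked-clash h up       up       eq with refl ← proj₂ (gap h up eq) = refl , refl
marked-clash h down     up       eq with p , refl ← gap h down eq = contradiction p (not-¬ refl)
marked-clash h flat     down     eq = contradiction (proj₂ (gap′ h flat (sym eq))) λ ()
marked-clash h up       down     eq with p , refl ← gap′ h up (sym eq) =
  contradiction (sym p) (not-¬ refl)
marked-clash h down     down     eq with refl ← proj₂ (gap′ h down (sym eq)) = refl , refl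

-- The construction and its 3-colourings with a single clashing edge.

Cell : Set
Cell = ℕ × ℕ

Pos : Set
Pos = Fin 2 × Cell

module _ {A P : Set} {x y : A} where

  if-yes : (d : Dec P) → P → (if does d then x else y) ≡ x
  if-yes d p = cong (if_then x else y) (dec-true d p)

  if-no : (d : Dec P) → ¬ P → (if does d then x else y) ≡ y
  if-no d ¬p = cong (if_then x else y) (dec-false d ¬p)

choose-≢ : ∀ {y z : Fin 3} {a b} → y ≢ z → b ≡ not a → (if a then y else z) ≢ (if b then y else z)
choose-≢ {a = true}  y≢z refl eq = y≢z eq
choose-≢ {a = false} y≢z refl eq = y≢z (sym eq)

choose-≢ˡ : ∀ {x y z : Fin 3} → x ≢ y → x ≢ z → ∀ a → x ≢ (if a then y else z)
choose-≢ˡ x≢y x≢z true  = x≢y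
choose-≢ˡ x≢y x≢z false = x≢z

Distinct : (x y z : Fin 3) → Set
Distinct x y z = x ≢ y × x ≢ z × y ≢ z

distinct₀₁₂ : Distinct 0F 1F 2F
distinct₀₁₂ = (λ ()) , (λ ()) , (λ ())

distinct₂₁₀ : Distinct 2F 1F 0F
distinct₂₁₀ = (λ ()) , (λ ()) , (λ ())

-- A vertex is given by its side, row and column.  Rows 0, …, h of a side are
-- the layers over its odd cycle, and row suc h is the independent set that is
-- completely joined to that of the other side.  Edges are oriented, to be
-- listed once.
module Construction (h L : ℕ) where

  infix 4 _⇢_ _⟶_

  data _⇢_ : Cell → Cell → Set where
    rung  : ∀ {j k c d} → j ≤ h → k ≤ h → RowStep j k → Next L c d → (j , c) ⇢ (k , d)
    spoke : ∀ {c} → (h , c) ⇢ (suc h , c)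

  data _⟶_ : Pos → Pos → Set where
    within : ∀ {σ x y} → x ⇢ y → (σ , x) ⟶ (σ , y)
    across : ∀ {c d} → (0F , suc h , c) ⟶ (1F , suc h , d)

  _⇢?_ : ∀ x y → Dec (x ⇢ y)
  (j , c) ⇢? (k , d) = map′ to from
    ((j ≤? h ×-dec k ≤? h ×-dec rowStep? j k ×-dec next? L c d) ⊎-dec
     (j ≟ h ×-dec k ≟ suc h ×-dec c ≟ d))
    where
    to : (j ≤ h × k ≤ h × RowStep j k × Next L c d) ⊎ (j ≡ h × k ≡ suc h × c ≡ d) →
      (j , c) ⇢ (k , d)
    to (inj₁ (p , q , r , n))         = rung p q r n
    to (inj₂ (refl , refl , refl))    = spoke

    from : (j , c) ⇢ (k , d) →
      (j ≤ h × k ≤ h × RowStep j k × Next L c d) ⊎ (j ≡ h × k ≡ suc h × c ≡ d)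
    from (rung p q r n) = inj₁ (p , q , r , n)
    from spoke          = inj₂ (refl , refl , refl)

  _⟶?_ : ∀ x y → Dec (x ⟶ y)
  (σ , j , c) ⟶? (τ , k , d) = map′ to from
    ((σ Fin.≟ τ ×-dec (j , c) ⇢? (k , d)) ⊎-dec
     (σ Fin.≟ 0F ×-dec τ Fin.≟ 1F ×-dec j ≟ suc h ×-dec k ≟ suc h))
    where
    to : (σ ≡ τ × (j , c) ⇢ (k , d)) ⊎ (σ ≡ 0F × τ ≡ 1F × j ≡ suc h × k ≡ suc h) →
      (σ , j , c) ⟶ (τ , k , d)
    to (inj₁ (refl , e))                  = within e
    to (inj₂ (refl , refl , refl , refl)) = across

    from : (σ , j , c) ⟶ (τ , k , d) →
      (σ ≡ τ × (j , c) ⇢ (k , d)) ⊎ (σ ≡ 0F × τ ≡ 1F × j ≡ suc h × k ≡ suc h)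
    from (within e) = inj₁ (refl , e)
    from across     = inj₂ (refl , refl , refl , refl)

  ⟶-irrefl : 0 < L → ∀ {x} → ¬ x ⟶ x
  ⟶-irrefl 0<L (within (rung _ _ _ n)) = next-irrefl 0<L n

  stack : (ℕ → ℕ → Fin 3) → (ℕ → Fin 3) → Cell → Fin 3
  stack body top (j , c) = if j ≤ᵇ h then body j c else top c

  module _ (body : ℕ → ℕ → Fin 3) (top : ℕ → Fin 3) where

    stack-body : ∀ {j} → j ≤ h → ∀ c → stack body top (j , c) ≡ body j c
    stack-body {j} j≤h c = if-yes (j ≤? h) j≤h

    stack-top : ∀ c → stack body top (suc h , c) ≡ top c
    stack-top c = if-no (suc h ≤? h) 1+n≰n

  module Colourings (L-even : odd L ≡ false) (1<L : 1 < L) where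

    -- The alternation of `y` and `z` fails only on the edge entering `i`, where `x` repairs it.
    column : (x y z : Fin 3) → ℕ → ℕ → Fin 3
    column x y z i c = if c ≡ᵇ i then x else if alternating i c then y else z

    module _ (x y z : Fin 3) (i : ℕ) where

      column-at : ∀ {c} → c ≡ i → column x y z i c ≡ x
      column-at {c} c≡i = if-yes (c ≟ i) c≡i

      column-off : ∀ {c} → c ≢ i → column x y z i c ≡ (if alternating i c then y else z)
      column-off {c} c≢i = if-no (c ≟ i) c≢i

    module _ {x y z : Fin 3} (distinct : Distinct x y z) {i : ℕ} (i≤L : i ≤ L) where

      private
        x≢y = proj₁ distinct
        x≢z = proj₁ (proj₂ distinct)
        y≢z = proj₂ (proj₂ distinct)

      column-off-≢ : ∀ {c} → c ≢ i → column x y z i c ≢ x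
      column-off-≢ {c} c≢i eq =
        choose-≢ˡ x≢y x≢z (alternating i c) (trans (sym eq) (column-off x y z i c≢i))

      column-next : ∀ {c d} → Next L c d → column x y z i c ≢ column x y z i d
      column-next {c} {d} n with c ≟ i | d ≟ i
      ... | yes refl | yes refl = contradiction n (next-irrefl (<⇒≤ 1<L))
      ... | yes c≡i  | no  d≢i  = λ eq → column-off-≢ d≢i (trans (sym eq) (column-at x y z i c≡i))
      ... | no  c≢i  | yes d≡i  = λ eq → column-off-≢ c≢i (trans eq (column-at x y z i d≡i))
      ... | no  c≢i  | no  d≢i  = λ eq → choose-≢ {a = alternating i c} y≢z
        (alternating-next L-even i≤L n d≢i)
        (trans (sym (column-off x y z i c≢i)) (trans eq (column-off x y z i d≢i)))

      columns : ℕ → ℕ → Fin 3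
      columns _ = column x y z i

      pinned : (ℕ → Fin 3) → Cell → Fin 3
      pinned = stack columns

      pinned-top : ∀ top c → pinned top (suc h , c) ≡ top c
      pinned-top = stack-top columns

      -- Body colours depend on the column alone, so every rung is proper by `column-next` and only
      -- spokes can clash.
      pinned-clash : ∀ top {a b} → a ⇢ b → pinned top a ≡ pinned top b →
        ∃ λ c → a ≡ (h , c) × b ≡ (suc h , c) × column x y z i c ≡ top c
      pinned-clash top (rung {c = c} {d} p q _ n) eq = contradiction
        (trans (sym (stack-body columns top p c)) (trans eq (stack-body columns top q d)))
        (column-next n)
      pinned-clash top (spoke {c}) eq =
        c , refl , refl , trans (sym (stack-body columns top ≤-refl c)) (trans eq (pinned-top top c))

      -- The body has `x` only in column `i`, so the last row can be `x` everywhere else. This gives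
      -- a proper colouring of a half with a last row that avoids `z` and uses `y` only once.
      spotTop : ℕ → Fin 3
      spotTop c = if c ≡ᵇ i then y else x

      spot : Cell → Fin 3
      spot = pinned spotTop

      spot-top-at : spot (suc h , i) ≡ y
      spot-top-at = trans (pinned-top spotTop i) (if-yes (i ≟ i) refl)

      spot-top-off : ∀ {c} → c ≢ i → spot (suc h , c) ≡ x
      spot-top-off {c} c≢i = trans (pinned-top spotTop c) (if-no (c ≟ i) c≢i)

      spot-proper : ∀ {a b} → a ⇢ b → spot a ≢ spot b
      spot-proper e eq with pinned-clash spotTop e eq
      ... | c , _ , _ , eq′ with c ≟ i
      ... | yes refl = x≢y (trans (sym (column-at x y z c refl)) (trans eq′ (if-yes (c ≟ c) refl)))
      ... | no  c≢i  = column-off-≢ c≢i (trans eq′ (if-no (c ≟ i) c≢i))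

    module Severed {j k c₀ c₁ : ℕ} (j≤h : j ≤ h) (k≤h : k ≤ h)
      (e : RowStep j k) (n₀ : Next L c₀ c₁) where

      -- Between `c₀` and `c₁` the alternation fails, so properness there rests on the marks alone:
      -- of the two ends of a rung other than `e` exactly one is marked.
      inCut : ℕ → ℕ → Bool
      inCut y c = if c ≡ᵇ c₁ then marked h e true y else
                  if c ≡ᵇ c₀ then marked h e false y else false

      body : ℕ → ℕ → Fin 3
      body y c = if inCut y c then 0F else if alternating c₁ c then 1F else 2F

      severed : Cell → Fin 3
      severed = stack body (λ _ → 0F)

      c₀≢c₁ : c₀ ≢ c₁
      c₀≢c₁ refl = next-irrefl (<⇒≤ 1<L) n₀

      inCut-target : ∀ y → inCut y c₁ ≡ marked h e true y
      inCut-target y = if-yes (c₁ ≟ c₁) refl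

      inCut-source : ∀ y → inCut y c₀ ≡ marked h e false y
      inCut-source y = trans (if-no (c₀ ≟ c₁) c₀≢c₁) (if-yes (c₀ ≟ c₀) refl)

      inCut-column : ∀ {y c} → inCut y c ≡ true → c ≡ c₀ ⊎ c ≡ c₁
      inCut-column {y} {c} eq with c ≟ c₁ | c ≟ c₀
      ... | yes c≡c₁ | _        = inj₂ c≡c₁
      ... | no  _    | yes c≡c₀ = inj₁ c≡c₀
      ... | no  c≢c₁ | no  c≢c₀ = contradiction (trans (sym eq)
        (trans (if-no (c ≟ c₁) c≢c₁) (if-no (c ≟ c₀) c≢c₀))) λ ()

      -- This keeps `0F` off row `h`, so that the whole last row can take it.
      inCut-top : ∀ c → inCut h c ≡ false
      inCut-top c with c ≡ᵇ c₁ | c ≡ᵇ c₀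
      ... | true  | _     = marked-top e j≤h k≤h true
      ... | false | true  = marked-top e j≤h k≤h false
      ... | false | false = refl

      body-clash : ∀ {y z c d} → Next L c d → body y c ≡ body z d →
        inCut y c ≡ inCut z d × (inCut y c ≡ true ⊎ alternating c₁ c ≡ alternating c₁ d)
      body-clash {y} {z} {c} {d} n eq
        with inCut y c | inCut z d | alternating c₁ c | alternating c₁ d
      ... | true  | true  | _     | _     = refl , inj₁ refl
      ... | false | false | true  | true  = refl , inj₂ refl
      ... | false | false | false | false = refl , inj₂ refl
      body-clash {y} {z} {c} {d} n () | true | false | _ | true
      body-clash {y} {z} {c} {d} n () | true | false | _ | false
      body-clash {y} {z} {c} {d} n () | false | true | true | _
      body-clash {y} {z} {c} {d} n () | false | true | false | _
      body-clash {y} {z} {c} {d} n () | false | false | true | false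
      body-clash {y} {z} {c} {d} n () | false | false | false | true

      severed-clash : ∀ {a b} → a ⇢ b → severed a ≡ severed b → a ≡ (j , c₀) × b ≡ (k , c₁)
      severed-clash (spoke {c}) eq = contradiction
        (trans (sym (stack-body body _ ≤-refl c)) (trans eq (stack-top body _ c)))
        (subst (λ b → (if b then 0F else if alternating c₁ c then 1F else 2F) ≢ 0F)
          (sym (inCut-top c)) (choose-≢ˡ {0F} (λ ()) (λ ()) (alternating c₁ c) ∘ sym))
      severed-clash (rung {y} {z} {c} {d} p q s n) eq
        with body-clash {y} {z} n
          (trans (sym (stack-body body _ p c)) (trans eq (stack-body body _ q d)))
      ... | cut≡ , alt with d ≟ c₁
      ... | yes refl with refl ← next-injective n n₀ =
        let (y≡j , z≡k) = marked-clash h e s (trans (sym (inCut-source y)) (trans cut≡ (inCut-target z)))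
        in cong (_, c₀) y≡j , cong (_, c₁) z≡k
      ... | no d≢c₁ with alt
      ... | inj₂ alt≡ = contradiction (alternating-next L-even (next-≤ʳ n₀) n d≢c₁) (not-¬ (sym alt≡))
      -- With both ends marked on a rung not entering `c₁`, the rung would be a loop at `c₀` or lead
      -- from `c₁` back to `c₀`; both are impossible as `1 < L`.
      ... | inj₁ cut with inCut-column {y} {c} cut | inCut-column {z} {d} (trans (sym cut≡) cut)
      ... | _         | inj₂ d≡c₁ = contradiction d≡c₁ d≢c₁
      ... | inj₁ refl | inj₁ refl = contradiction n (next-irrefl (<⇒≤ 1<L))
      ... | inj₂ refl | inj₁ refl = contradiction n (next-asym 1<L n₀)

    -- The last row is all `0F`, which leaves the other half free to use a `spot` colouring whose
    -- last row avoids `0F`. For a spoke, `0F` occurs in the body only in the column of that spoke.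
    half-critical : ∀ {a b} → a ⇢ b → proj₂ a ≤ L → ∃ λ χ → (∀ c → χ (suc h , c) ≡ 0F) ×
      (∀ {x y} → x ⇢ y → χ x ≡ χ y → x ≡ a × y ≡ b)
    half-critical (rung p q s n) _ = severed , stack-top body _ , severed-clash
      where open Severed p q s n
    half-critical (spoke {i}) i≤L =
      pinned distinct₀₁₂ i≤L (λ _ → 0F) , pinned-top distinct₀₁₂ i≤L _ , clash
      where
      clash : ∀ {x y} → x ⇢ y → _ → x ≡ (h , i) × y ≡ (suc h , i)
      clash e eq with pinned-clash distinct₀₁₂ i≤L _ e eq
      ... | c , x≡ , y≡ , eq′ with c ≟ i
      ... | yes refl = x≡ , y≡
      ... | no  c≢i  = contradiction eq′ (column-off-≢ distinct₀₁₂ i≤L c≢i)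

    critical-colouring : ∀ {a b} → a ⟶ b → proj₂ (proj₂ a) ≤ L → proj₂ (proj₂ b) ≤ L →
      ∃ λ (χ : Pos → Fin 3) → ∀ {x y} → x ⟶ y → χ x ≡ χ y → x ≡ a × y ≡ b
    critical-colouring (within {σ} {a} {b} e) a≤L _ with half-critical e a≤L
    ... | χ₀ , top , clash = χ , λ {x} {y} → χ-clash {x} {y}
      where
      other : Cell → Fin 3
      other = spot distinct₂₁₀ z≤n

      other-top : ∀ c → other (suc h , c) ≢ 0F
      other-top c eq with c ≟ 0
      ... | yes refl = contradiction (trans (sym eq) (spot-top-at distinct₂₁₀ z≤n)) λ ()
      ... | no  c≢0  = contradiction (trans (sym eq) (spot-top-off distinct₂₁₀ z≤n c≢0)) λ ()

      two-sides : ∀ {A : Set} τ → 0F ≢ τ → 1F ≢ τ → A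
      two-sides 0F p _ = contradiction refl p
      two-sides 1F _ p = contradiction refl p

      χ : Pos → Fin 3
      χ (τ , x) with τ Fin.≟ σ
      ... | yes _ = χ₀ x
      ... | no  _ = other x

      χ-clash : ∀ {x y} → x ⟶ y → χ x ≡ χ y → x ≡ (σ , a) × y ≡ (σ , b)
      χ-clash (within {τ} f) eq with τ Fin.≟ σ
      ... | yes refl = let (p , q) = clash f eq in cong (σ ,_) p , cong (σ ,_) q
      ... | no  _    = contradiction eq (spot-proper distinct₂₁₀ z≤n f)
      χ-clash (across {c} {d}) eq with 0F Fin.≟ σ | 1F Fin.≟ σ
      ... | yes refl | yes ()
      ... | yes refl | no  _    = contradiction (trans (sym eq) (top c)) (other-top d)
      ... | no  _    | yes refl = contradiction (trans eq (top d)) (other-top c)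
      ... | no  0≢σ  | no  1≢σ  = two-sides σ 0≢σ 1≢σ
    -- The last rows use 0 and 1 on the left, 2 and 1 on the right; the shared colour 1 occurs once
    -- in each, at the ends of the given edge.
    critical-colouring (across {i} {i′}) i≤L i′≤L = χ , λ {x} {y} → χ-clash {x} {y}
      where
      left right : Cell → Fin 3
      left  = spot distinct₀₁₂ i≤L
      right = spot distinct₂₁₀ i′≤L

      χ : Pos → Fin 3
      χ (0F , x) = left x
      χ (1F , x) = right x

      χ-clash : ∀ {x y} → x ⟶ y → χ x ≡ χ y → x ≡ (0F , suc h , i) × y ≡ (1F , suc h , i′)
      χ-clash (within {0F} f) eq = contradiction eq (spot-proper distinct₀₁₂ i≤L f)
      χ-clash (within {1F} f) eq = contradiction eq (spot-proper distinct₂₁₀ i′≤L f)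
      χ-clash (across {c} {d}) eq with c ≟ i | d ≟ i′
      ... | yes refl | yes refl = refl , refl
      ... | yes refl | no  d≢i′ = contradiction
        (trans (sym (spot-top-at distinct₀₁₂ i≤L))
          (trans eq (spot-top-off distinct₂₁₀ i′≤L d≢i′))) λ ()
      ... | no  c≢i  | yes refl = contradiction
        (trans (sym (spot-top-off distinct₀₁₂ i≤L c≢i))
          (trans eq (spot-top-at distinct₂₁₀ i′≤L))) λ ()
      ... | no  c≢i  | no  d≢i′ = contradiction
        (trans (sym (spot-top-off distinct₀₁₂ i≤L c≢i))
          (trans eq (spot-top-off distinct₂₁₀ i′≤L d≢i′))) λ ()

-- Finite search, odd girth, closed walks and a criterion for criticality.

flip-sym : ∀ {a b} → a ≡ not b → b ≡ not a
flip-sym {b = b} eq = trans (sym (not-involutive b)) (cong not (sym eq))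

¬T-not : ∀ {b} → T (not b) → ¬ T b
¬T-not {false} _ ()

suc-% : ∀ n t .{{_ : NonZero n}} → suc t % n ≡ suc (t % n) % n
suc-% n t = trans (cong ((_% n) ∘ suc) (m≡m%n+[m/n]*n t n))
  ([m+kn]%n≡m%n (suc (t % n)) (t ℕ./ n) n)

T-both : ∀ {P Q : Set} (p : Dec P) (q : Dec Q) → P → Q → T (⌊ p ⌋ ∧ ⌊ q ⌋)
T-both (yes _) (yes _) _ _ = _
T-both (no ¬p) _       p _ = ¬p p
T-both (yes _) (no ¬q) _ q = ¬q q

next-% : ∀ L t → Next L (t % suc L) (suc t % suc L)
next-% L t with suc (t % suc L) ≟ suc L
... | yes eq = subst₂ (Next L) (sym (suc-injective eq))
  (sym (trans (suc-% (suc L) t) (trans (cong (_% suc L) eq) (n%n≡0 (suc L))))) wrap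
... | no  ne = subst (Next L (t % suc L))
  (sym (trans (suc-% (suc L) t) (m<n⇒m%n≡m lt))) (next (s<s⁻¹ lt))
  where
  lt : suc (t % suc L) < suc L
  lt = ≤∧≢⇒< (m%n<n t (suc L)) ne

missing-value : ∀ {m n} → m < n → (f : Fin m → Fin n) → ∃ λ i → ∀ t → f t ≢ i
missing-value {m} {n} m<n f =
  let (i , missed) = Fin.¬∀⟶∃¬ n _ (λ i → any? λ t → f t Fin.≟ i) not-onto
  in i , λ t eq → missed (t , eq)
  where
  not-onto : ¬ (∀ i → ∃ λ t → f t ≡ i)
  not-onto onto = <⇒≱ m<n (Fin.injective⇒≤ {f = proj₁ ∘ onto} λ {i} {j} eq →
    trans (sym (proj₂ (onto i))) (trans (cong f eq) (proj₂ (onto j))))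

least : ∀ {P : ℕ → Set} → (∀ n → Dec (P n)) → ∀ n → P n → ∃ λ g → P g × (∀ m → P m → g ≤ m)
least {P} P? = <-rec _ λ n rec Pn → search n rec Pn (anyUpTo? P? n)
  where
  search : ∀ n → (∀ {k} → k < n → P k → ∃ λ g → P g × (∀ m → P m → g ≤ m)) → P n →
    Dec (∃ λ k → k < n × P k) → ∃ λ g → P g × (∀ m → P m → g ≤ m)
  search n rec Pn (yes (k , k<n , Pk)) = rec k<n Pk
  search n rec Pn (no none) = n , Pn , λ m Pm → ≮⇒≥ λ m<n → none (m , m<n , Pm)

-- Functions are enumerated through `funToFin`. The round trip returns a function only up to
-- pointwise equality, which `P` must therefore respect.
any-function? : ∀ {m n} {P : (Fin m → Fin n) → Set} → (∀ {f g} → f ≗ g → P f → P g) →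
  (∀ f → Dec (P f)) → Dec (∃ P)
any-function? resp P? = map′
  (λ (k , p) → finToFun k , p)
  (λ (f , p) → funToFin f , resp (sym ∘ Fin.finToFun-funToFin f) p)
  (any? (P? ∘ finToFun))

module _ (G : Graph) where

  cycle? : ∀ m → Dec (Cycle G m)
  cycle? m = map′
    (λ (3≤m , f , inj , st , cl) → record
      { length≥3 = 3≤m ; vertex = f ; injective = inj _ _ ; step = st ; close = cl })
    (λ C → let open Cycle C in length≥3 , vertex , (λ i j → injective) , step , close)
    (3 ≤? m ×-dec any-function?
      (λ f≗g (inj , st , cl) →
        (λ i j eq → inj i j (trans (f≗g i) (trans eq (sym (f≗g j))))) ,
        (λ i j eq → subst₂ (Adj G) (f≗g i) (f≗g j) (st i j eq)) ,
        (λ i j eq eq′ → subst₂ (Adj G) (f≗g i) (f≗g j) (cl i j eq eq′)))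
      λ f →
        (all? λ i → all? λ j → f i Fin.≟ f j →-dec i Fin.≟ j) ×-dec
        (all? λ i → all? λ j → toℕ j ≟ suc (toℕ i) →-dec T? (adj G (f i) (f j))) ×-dec
        (all? λ i → all? λ j → suc (toℕ i) ≟ m →-dec (toℕ j ≟ 0 →-dec T? (adj G (f i) (f j)))))

  oddGirthAbove : ∀ ℓ → ∃ (OddCycle G) → (∀ m → OddCycle G m → ℓ < m) → OddGirthAbove ℓ G
  oddGirthAbove ℓ (n , C) above with least (λ m → ¬? (2 ∣? m) ×-dec cycle? m) n C
  ... | g , Cg , minimal = g , (Cg , minimal) , above g Cg

  -- Indexing by all of ℕ lets the walk be restarted at any of its edges.
  closed-walk : ∀ {n} → Cycle G (suc n) →
    ∃ λ (w : ℕ → Vertex G) → (∀ t → w (t + suc n) ≡ w t) × (∀ t → Adj G (w t) (w (suc t)))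
  closed-walk {n} C = w ,
    (λ t → cong vertex (mod-cong (t + suc n) t ([m+n]%n≡m%n t (suc n)))) ,
    λ t → edge _ _ (toℕ-mod t) (toℕ-mod (suc t)) (next-% n t)
    where
    open Cycle C

    w : ℕ → Vertex G
    w t = vertex (t mod suc n)

    toℕ-mod : ∀ t → toℕ (t mod suc n) ≡ t % suc n
    toℕ-mod t = Fin.toℕ-fromℕ< (m%n<n t (suc n))

    mod-cong : ∀ t u → t % suc n ≡ u % suc n → t mod suc n ≡ u mod suc n
    mod-cong t u eq = Fin.toℕ-injective (trans (toℕ-mod t) (trans eq (sym (toℕ-mod u))))

    edge : ∀ i j {c d} → toℕ i ≡ c → toℕ j ≡ d → Next n c d → Adj G (vertex i) (vertex j)
    edge i j i≡ j≡ (next _) = step i j (trans j≡ (cong suc (sym i≡)))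
    edge i j i≡ j≡ wrap     = close i j (cong suc i≡) j≡

  -- A 3-colouring that clashes only on the edge `u v` serves twice: it is proper once the edge is
  -- removed, and giving `u` a fourth colour makes it proper on `G`.
  critical : ¬ Colourable G 3 → (∃ λ u → ∃ (Adj G u)) →
    (∀ u v → Adj G u v → ∃ λ (χ : Vertex G → Fin 3) → ∀ x y → Adj G x y → χ x ≡ χ y →
      (x ≡ u × y ≡ v) ⊎ (x ≡ v × y ≡ u)) →
    Critical 4 G
  critical not-3 (u , v , uv) clash =
    (four (clash u v uv) , λ j (χ , proper) → ≰⇒> λ j≤3 →
      not-3 ((λ x → inject≤ (χ x) j≤3) , λ x y xy eq →
        proper x y xy (Fin.inject≤-injective j≤3 j≤3 _ _ eq))) ,
    λ u v uv → let (χ , only) = clash u v uv in χ , λ x y xy eq →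
      let (Gxy , rest) = Equivalence.to T-∧ xy
      in ¬T-not rest (Equivalence.from T-∨ (both-eq (only x y Gxy eq)))
    where
    both-eq : ∀ {u v x y : Vertex G} → (x ≡ u × y ≡ v) ⊎ (x ≡ v × y ≡ u) →
      T (⌊ x Fin.≟ u ⌋ ∧ ⌊ y Fin.≟ v ⌋) ⊎ T (⌊ x Fin.≟ v ⌋ ∧ ⌊ y Fin.≟ u ⌋)
    both-eq {u} {v} {x} {y} (inj₁ (p , q)) = inj₁ (T-both (x Fin.≟ u) (y Fin.≟ v) p q)
    both-eq {u} {v} {x} {y} (inj₂ (p , q)) = inj₂ (T-both (x Fin.≟ v) (y Fin.≟ u) p q)

    four : _ → Colourable G 4
    four (χ , only) = χ₄ , proper
      where
      χ₄ : Vertex G → Fin 4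
      χ₄ x with x Fin.≟ u
      ... | yes _ = 3F
      ... | no  _ = inject₁ (χ x)

      proper : ∀ x y → Adj G x y → χ₄ x ≢ χ₄ y
      proper x y xy eq with x Fin.≟ u | y Fin.≟ u
      ... | yes refl | yes refl = subst T (no-loop G x) xy
      ... | yes _    | no  _    = Fin.fromℕ≢inject₁ eq
      ... | no  _    | yes _    = Fin.fromℕ≢inject₁ (sym eq)
      ... | no  x≢u  | no  y≢u  with only x y xy (Fin.inject₁-injective eq)
      ... | inj₁ (x≡u , _) = x≢u x≡u
      ... | inj₂ (_ , y≡u) = y≢u y≡u

-- Short odd closed walks do not exist.

module Walks (h L : ℕ) (L-even : odd L ≡ false) where
  open Construction h L

  Edge : Pos → Pos → Set
  Edge x y = x ⟶ y ⊎ y ⟶ x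

  side : Pos → Fin 2
  side = proj₁

  row col : Pos → ℕ
  row (_ , j , _) = j
  col (_ , _ , c) = c

  -- A 2-colouring proper on all edges outside the two odd cycles. Edges between the halves keep the
  -- row, hence the contribution of the side.
  level : Pos → Bool
  level x = odd (toℕ (side x) + row x)

  Flat : Pos → Pos → Set
  Flat x y = row x ≡ 0 × row y ≡ 0

  level-⟶ : ∀ {x y} → x ⟶ y → ¬ Flat x y → level y ≡ not (level x)
  level-⟶ (within (rung _ _ flat _)) bent = contradiction (refl , refl) bent
  level-⟶ (within {σ} (rung {j = j} _ _ up _))   _ = cong odd (+-suc (toℕ σ) j)
  level-⟶ (within {σ} (rung {k = k} _ _ down _)) _ = flip-sym (cong odd (+-suc (toℕ σ) k))
  level-⟶ (within {σ} spoke) _ = cong odd (+-suc (toℕ σ) h)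
  level-⟶ across _ = refl

  level-edge : ∀ {x y} → Edge x y → ¬ Flat x y → level y ≡ not (level x)
  level-edge (inj₁ e) bent = level-⟶ e bent
  level-edge (inj₂ e) bent = flip-sym (level-⟶ e λ (p , q) → bent (q , p))

  low-edge : ∀ {x y} → Edge x y → row x ≤ h → side y ≡ side x × row y ≤ suc (row x)
  low-edge (inj₁ (within (rung _ _ flat _))) _ = refl , z≤n
  low-edge (inj₁ (within (rung _ _ up _)))   _ = refl , ≤-refl
  low-edge (inj₁ (within (rung _ _ down _))) _ = refl , ≤-trans (n≤1+n _) (n≤1+n _)
  low-edge (inj₁ (within spoke))             _ = refl , ≤-refl
  low-edge (inj₁ across)                     p = contradiction p 1+n≰n
  low-edge (inj₂ (within (rung _ _ flat _))) _ = refl , z≤n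
  low-edge (inj₂ (within (rung _ _ up _)))   _ = refl , ≤-trans (n≤1+n _) (n≤1+n _)
  low-edge (inj₂ (within (rung _ _ down _))) _ = refl , ≤-refl
  low-edge (inj₂ (within spoke))             p = contradiction p 1+n≰n
  low-edge (inj₂ across)                     p = contradiction p 1+n≰n

  -- An edge changes the side only when it leaves row `suc h`, and a walk from row 0 takes at least
  -- `suc h` steps to get there.
  stay : (v : ℕ → Pos) → ∀ n → n ≤ suc h → (∀ t → t < n → Edge (v t) (v (suc t))) →
    row (v 0) ≡ 0 → ∀ t → t ≤ n → side (v t) ≡ side (v 0) × row (v t) ≤ t
  stay v n n≤ edges start zero    _   = refl , ≤-reflexive start
  stay v n n≤ edges start (suc t) t<n with stay v n n≤ edges start t (<⇒≤ t<n)
  ... | side≡ , row≤ with low-edge (edges t t<n) (≤-trans row≤ (s≤s⁻¹ (≤-trans t<n n≤)))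
  ... | side≡′ , row≤′ = trans side≡′ side≡ , ≤-trans row≤′ (s≤s row≤)

  -- The 2-colouring of a half without column `i`; the switch above row `h` accounts for spokes,
  -- which stay in their column.
  sheet : ℕ → Pos → Bool
  sheet i x = alternating i (col x) xor (h <ᵇ row x)

  module _ {i : ℕ} (i≤L : i ≤ L) where

    sheet-⟶ : ∀ {x y} → x ⟶ y → side x ≡ side y → col y ≢ i → sheet i y ≡ not (sheet i x)
    sheet-⟶ (within (rung {j} {k} {c} {d} p q _ n)) _ d≢i = begin
      alternating i d xor (h <ᵇ k)
        ≡⟨ cong (alternating i d xor_) (dec-false (h <? k) (≤⇒≯ q)) ⟩
      alternating i d xor false
        ≡⟨ cong (_xor false) (alternating-next L-even i≤L n d≢i) ⟩
      not (alternating i c) xor false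
        ≡⟨ not-distribˡ-xor (alternating i c) false ⟨
      not (alternating i c xor false)
        ≡⟨ cong (λ b → not (alternating i c xor b)) (dec-false (h <? j) (≤⇒≯ p)) ⟨
      not (alternating i c xor (h <ᵇ j)) ∎
      where open ≡-Reasoning
    sheet-⟶ (within (spoke {c})) _ _ = begin
      alternating i c xor (h <ᵇ suc h)
        ≡⟨ cong (alternating i c xor_) (dec-true (h <? suc h) ≤-refl) ⟩
      alternating i c xor true
        ≡⟨ not-distribʳ-xor (alternating i c) false ⟨
      not (alternating i c xor false)
        ≡⟨ cong (λ b → not (alternating i c xor b)) (dec-false (h <? h) (<-irrefl refl)) ⟨
      not (alternating i c xor (h <ᵇ h)) ∎
      where open ≡-Reasoning
    sheet-⟶ across () _

    sheet-edge : ∀ {x y} → Edge x y → side x ≡ side y → col x ≢ i → col y ≢ i →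
      sheet i y ≡ not (sheet i x)
    sheet-edge (inj₁ e) s _ y≢i = sheet-⟶ e s y≢i
    sheet-edge (inj₂ e) s x≢i _ = flip-sym (sheet-⟶ e (sym s) x≢i)

  module _ (w : ℕ → Pos) (q : ℕ) (q≤ : q ≤ suc h) (short : suc (q + q) ≤ L)
    (closed : w (suc (q + q)) ≡ w 0) (edges : ∀ t → Edge (w t) (w (suc t)))
    (cols : ∀ t → col (w t) ≤ L) where

    private
      m = suc (q + q)

    odd-m : odd m ≡ true
    odd-m = cong not (odd-+-self q)

    same-colour : (κ : Pos → Bool) → ¬ (∀ t → t < m → κ (w (suc t)) ≡ not (κ (w t)))
    same-colour κ f = not-¬ {κ (w 0)} refl (trans (sym (cong κ closed))
      (trans (flips⇒odd (κ ∘ w) m f) (cong (_xor κ (w 0)) odd-m)))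

    -- Every vertex of the walk is at most `q` steps after `w 1` or at most `q` steps before `w m`,
    -- which is `w 0`. Both of these lie in row 0, so by `stay` the walk keeps to one side. Its `m`
    -- vertices miss one of the `suc L` columns, and `sheet` for that column alternates along it.
    no-flat-start : ¬ Flat (w 0) (w 1)
    no-flat-start (row0 , row1)
      with missing-value (s≤s short) (λ (t : Fin m) → fromℕ< (s≤s (cols (toℕ t))))
    ... | i , missed = same-colour (sheet (toℕ i)) λ t t<m →
      sheet-edge (s≤s⁻¹ (Fin.toℕ<n i)) (edges t)
        (trans (one-side t (<⇒≤ t<m)) (sym (one-side (suc t) t<m)))
        (avoids t (<⇒≤ t<m)) (avoids (suc t) t<m)
      where
      avoids< : ∀ t → t < m → col (w t) ≢ toℕ i
      avoids< t t<m eq = missed (fromℕ< t<m) (Fin.toℕ-injective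
        (trans (Fin.toℕ-fromℕ< _) (trans (cong (col ∘ w) (Fin.toℕ-fromℕ< t<m)) eq)))

      avoids : ∀ t → t ≤ m → col (w t) ≢ toℕ i
      avoids t t≤m with m≤n⇒m<n∨m≡n t≤m
      ... | inj₁ t<m  = avoids< t t<m
      ... | inj₂ refl = subst (λ x → col x ≢ toℕ i) (sym closed) (avoids< 0 z<s)

      forth : ∀ t → t ≤ q → side (w (suc t)) ≡ side (w 0)
      forth t t≤q = trans
        (proj₁ (stay (w ∘ suc) q q≤ (λ t _ → edges (suc t)) row1 t t≤q))
        (proj₁ (low-edge (edges 0) (≤-trans (≤-reflexive row0) z≤n)))

      back : ∀ t → t ≤ q → side (w (m ∸ t)) ≡ side (w 0)
      back t t≤q = trans
        (proj₁ (stay (w ∘ (m ∸_)) q q≤ reversed (trans (cong row closed) row0) t t≤q))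
        (cong side closed)
        where
        reversed : ∀ t → t < q → Edge (w (m ∸ t)) (w (m ∸ suc t))
        reversed t t<q = subst (λ k → Edge (w k) (w (q + q ∸ t)))
          (sym (+-∸-assoc 1 (≤-trans (<⇒≤ t<q) (m≤m+n q q)))) (swap (edges (q + q ∸ t)))

      one-side : ∀ t → t ≤ m → side (w t) ≡ side (w 0)
      one-side zero    _   = refl
      one-side (suc t) t<m with t ≤? q
      ... | yes t≤q = forth t t≤q
      ... | no  t≰q = subst (λ k → side (w k) ≡ side (w 0)) (m∸[m∸n]≡n t<m)
        (back (q + q ∸ t) (m≤n+o⇒m∸n≤o (q + q) t (+-monoˡ-≤ q (<⇒≤ (≰⇒> t≰q)))))

  -- `level` cannot alternate along all of an odd closed walk, so some edge is flat; but the walk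
  -- restarted there contradicts `no-flat-start`.
  no-short-odd-closed-walk : (w : ℕ → Pos) → ∀ q → q ≤ suc h → suc (q + q) ≤ L →
    (∀ t → w (t + suc (q + q)) ≡ w t) → (∀ t → Edge (w t) (w (suc t))) →
    ¬ (∀ t → col (w t) ≤ L)
  no-short-odd-closed-walk w q q≤ short periodic edges cols =
    same-colour w q q≤ short (periodic 0) edges cols level λ t _ →
      level-edge (edges t) λ f → no-flat-start (w ∘ (_+ t)) q q≤ short
        (trans (cong w (+-comm m t)) (periodic t)) (λ k → edges (k + t)) (λ k → cols (k + t)) f
    where m = suc (q + q)

-- Counting edges and numbering the vertices.

module _ (G : Graph) where

  ∈-edges : ∀ {u v : Vertex G} → u Fin.< v → Adj G u v → (u , v) ∈ edges G
  ∈-edges {u} {v} u<v uv = ∈-filter⁺ (λ (u , v) → (u Fin.<? v) ×-dec T? (adj G u v))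
    (∈-cartesianProduct⁺ (∈-allFin u) (∈-allFin v)) (u<v , uv)

  size-≥ : ∀ {n} (f : Fin n → Vertex G × Vertex G) → (∀ {i j} → f i ≡ f j → i ≡ j) →
    (∀ i → f i ∈ edges G) → n ≤ size G
  size-≥ f injective f∈ = Fin.injective⇒≤ {f = index ∘ f∈} λ {i} {j} eq → injective
    (trans (lookup-index (f∈ i)) (trans (cong (lookup (edges G)) eq) (sym (lookup-index (f∈ j)))))

combine-monoʳ-< : ∀ {m n} (i : Fin m) {j k : Fin n} → j Fin.< k → combine i j Fin.< combine i k
combine-monoʳ-< {n = n} i {j} {k} j<k =
  subst₂ _<_ (sym (Fin.toℕ-combine i j)) (sym (Fin.toℕ-combine i k)) (+-monoʳ-< (n * toℕ i) j<k)

module Triples (l a b : ℕ) where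

  encode : Fin l × Fin a × Fin b → Fin (l * (a * b))
  encode (i , j , k) = combine i (combine j k)

  decode : Fin (l * (a * b)) → Fin l × Fin a × Fin b
  decode v = map₂ (remQuot {a} b) (remQuot {l} (a * b) v)

  decode-encode : ∀ x → decode (encode x) ≡ x
  decode-encode (i , j , k) = trans
    (cong (map₂ (remQuot {a} b)) (Fin.remQuot-combine i (combine j k)))
    (cong (i ,_) (Fin.remQuot-combine j k))

  encode-decode : ∀ v → encode (decode v) ≡ v
  encode-decode v = let (i , w) = remQuot {l} (a * b) v in
    trans (cong (combine i) (Fin.combine-remQuot {a} b w)) (Fin.combine-remQuot {l} (a * b) v)

  -- Needed because `edges` lists the smaller endpoint first.
  encode-monoˡ-< : ∀ {i i′} x y → i Fin.< i′ → encode (i , x) Fin.< encode (i′ , y)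
  encode-monoˡ-< x y i<i′ =
    Fin.combine-monoˡ-< (combine (proj₁ x) (proj₂ x)) (combine (proj₁ y) (proj₂ y)) i<i′

  encode-monoᵐ-< : ∀ i {j j′} k k′ → j Fin.< j′ → encode (i , j , k) Fin.< encode (i , j′ , k′)
  encode-monoᵐ-< i k k′ j<j′ = combine-monoʳ-< i (Fin.combine-monoˡ-< k k′ j<j′)

-- The construction as a finite graph: criticality, odd girth and size.

module Tower (h L : ℕ) (L-even : odd L ≡ false) (1<L : 1 < L) where

  open Construction h L
  open Colourings L-even 1<L
  open Walks h L L-even

  height width : ℕ
  height = suc (suc h)
  width  = suc L

  n : ℕ
  n = 2 * (height * width)

  open Triples 2 height width

  place : Fin 2 × Fin height × Fin width → Pos
  place (σ , j , c) = σ , toℕ j , toℕ c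

  place-injective : ∀ {x y} → place x ≡ place y → x ≡ y
  place-injective eq = cong₂ _,_ (,-injectiveˡ eq) (cong₂ _,_
    (Fin.toℕ-injective (,-injectiveˡ (,-injectiveʳ eq)))
    (Fin.toℕ-injective (,-injectiveʳ (,-injectiveʳ eq))))

  opaque

    pos : Fin n → Pos
    pos v = place (decode v)

    -- Reducing the coordinates turns rows into periodic sequences.
    vertexAt : Fin 2 → ℕ → ℕ → Fin n
    vertexAt σ j c = encode (σ , j mod height , c mod width)

    pos-vertexAt : ∀ σ j c → pos (vertexAt σ j c) ≡ (σ , j % height , c % width)
    pos-vertexAt σ j c = trans (cong place (decode-encode (σ , j mod height , c mod width)))
      (cong₂ (λ j c → σ , j , c) (Fin.toℕ-fromℕ< (m%n<n j height)) (Fin.toℕ-fromℕ< (m%n<n c width)))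

    pos-injective : ∀ {u v} → pos u ≡ pos v → u ≡ v
    pos-injective {u} {v} eq = trans (sym (encode-decode u))
      (trans (cong encode (place-injective eq)) (encode-decode v))

    col-pos : ∀ v → col (pos v) ≤ L
    col-pos v = s≤s⁻¹ (Fin.toℕ<n (proj₂ (proj₂ (decode v))))

    side-< : ∀ j k c d → vertexAt 0F j c Fin.< vertexAt 1F k d
    side-< j k c d =
      encode-monoˡ-< {0F} {1F} (j mod height , c mod width) (k mod height , d mod width) z<s

    row-< : ∀ σ {j k} c d → j < k → k < height → vertexAt σ j c Fin.< vertexAt σ k d
    row-< σ {j} {k} c d j<k k< = encode-monoᵐ-< σ (c mod width) (d mod width)
      (subst₂ _<_ (toℕ-mod (<-trans j<k k<)) (toℕ-mod k<) j<k)
      where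
      toℕ-mod : ∀ {j} → j < height → j ≡ toℕ (j mod height)
      toℕ-mod {j} j< = sym (trans (Fin.toℕ-fromℕ< (m%n<n j height)) (m<n⇒m%n≡m j<))

    linked : Pos → Pos → Bool
    linked x y = ⌊ x ⟶? y ⌋ ∨ ⌊ y ⟶? x ⌋

    linked-sym : ∀ x y → linked x y ≡ linked y x
    linked-sym x y = ∨-comm ⌊ x ⟶? y ⌋ ⌊ y ⟶? x ⌋

    linked-irrefl : ∀ x → linked x x ≡ false
    linked-irrefl x with x ⟶? x
    ... | yes e = contradiction e (⟶-irrefl (<⇒≤ 1<L))
    ... | no  _ = refl

    linked⇒edge : ∀ {x y} → T (linked x y) → Edge x y
    linked⇒edge {x} {y} =
      Sum.map toWitness toWitness ∘ Equivalence.to (T-∨ {⌊ x ⟶? y ⌋} {⌊ y ⟶? x ⌋})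

    edge⇒linked : ∀ {x y} → Edge x y → T (linked x y)
    edge⇒linked {x} {y} =
      Equivalence.from (T-∨ {⌊ x ⟶? y ⌋} {⌊ y ⟶? x ⌋}) ∘ Sum.map fromWitness fromWitness

  tower : Graph
  tower = record
    { order   = n
    ; adj     = λ u v → linked (pos u) (pos v)
    ; adj-sym = λ u v → linked-sym (pos u) (pos v)
    ; no-loop = λ v → linked-irrefl (pos v)
    }

  pos-at : ∀ σ {j} c → j < height → pos (vertexAt σ j c) ≡ (σ , j , c % width)
  pos-at σ {j} c j< = trans (pos-vertexAt σ j c) (cong (λ j → σ , j , c % width) (m<n⇒m%n≡m j<))

  adj-vertexAt : ∀ {σ τ j k c d} → j < height → k < height →
    Edge (σ , j , c % width) (τ , k , d % width) → Adj tower (vertexAt σ j c) (vertexAt τ k d)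
  adj-vertexAt {σ} {τ} {c = c} {d} j< k< e =
    edge⇒linked (subst₂ Edge (sym (pos-at σ c j<)) (sym (pos-at τ d k<)) e)

  adj-rung : ∀ σ {j k} c → j ≤ h → k ≤ h → RowStep j k →
    Adj tower (vertexAt σ j c) (vertexAt σ k (suc c))
  adj-rung σ c j≤h k≤h s = adj-vertexAt (s≤s (m≤n⇒m≤1+n j≤h)) (s≤s (m≤n⇒m≤1+n k≤h))
    (inj₁ (within (rung j≤h k≤h s (next-% L c))))

  adj-spoke : ∀ σ c → Adj tower (vertexAt σ h c) (vertexAt σ (suc h) c)
  adj-spoke σ c = adj-vertexAt (s≤s (n≤1+n h)) ≤-refl (inj₁ (within spoke))

  adj-across : ∀ c d → Adj tower (vertexAt 0F (suc h) c) (vertexAt 1F (suc h) d)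
  adj-across c d = adj-vertexAt ≤-refl ≤-refl (inj₁ across)

  not-3-colourable : ¬ Colourable tower 3
  not-3-colourable (χ , proper) = not-constant 0F λ c → decide (top 0F c Fin.≟ top 0F 0)
    where
    open Winding width

    K : Fin 2 → ℕ → ℕ → Fin 3
    K σ j c = χ (vertexAt σ j c)

    top : Fin 2 → ℕ → Fin 3
    top σ = K σ (suc h)

    periodic : ∀ σ j → Periodic (K σ j)
    periodic σ j c = cong χ (pos-injective (trans (pos-vertexAt σ j (c + width))
      (trans (cong (λ c → σ , j % height , c) ([m+n]%n≡m%n c width)) (sym (pos-vertexAt σ j c)))))

    not-constant : ∀ σ → ¬ (∀ c → top σ c ≡ top σ 0)
    not-constant σ const = no-constant-row (cong not L-even) h (K σ) (top σ 0) (periodic σ)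
      ((λ c → proper _ _ (adj-rung σ c z≤n z≤n flat)) , λ c → proper _ _ (adj-rung σ c z≤n z≤n flat))
      (λ j j<h → (λ c → proper _ _ (adj-rung σ c (<⇒≤ j<h) j<h up)) ,
                  λ c → proper _ _ (adj-rung σ c j<h (<⇒≤ j<h) down))
      λ c eq → proper _ _ (adj-spoke σ c) (trans eq (sym (const c)))

    decide : ∀ {c} → Dec (top 0F c ≡ top 0F 0) → top 0F c ≡ top 0F 0
    decide (yes eq) = eq
    -- Two colours in the left last row leave a single one for the entire right last row.
    decide {c} (no two) = contradiction (λ d → third-colour _ _ (top 1F d) (top 1F 0) two
      (differ d c) (differ d 0) (differ 0 c) (differ 0 0)) (not-constant 1F)
      where
      differ : ∀ d c → top 1F d ≢ top 0F c
      differ d c eq = proper _ _ (adj-across c d) (sym eq)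

  tower-critical : Critical 4 tower
  tower-critical = critical tower not-3-colourable (_ , _ , adj-across 0 0) λ u v uv →
    colouring u v (linked⇒edge uv)
    where
    colouring : ∀ u v → Edge (pos u) (pos v) → ∃ λ (χ : Fin n → Fin 3) → ∀ x y → Adj tower x y →
      χ x ≡ χ y → (x ≡ u × y ≡ v) ⊎ (x ≡ v × y ≡ u)
    colouring u v (inj₁ e) with critical-colouring e (col-pos u) (col-pos v)
    ... | χ , clash = χ ∘ pos , λ x y xy eq → by (linked⇒edge xy) eq
      where
      by : ∀ {x y} → Edge (pos x) (pos y) → χ (pos x) ≡ χ (pos y) →
        (x ≡ u × y ≡ v) ⊎ (x ≡ v × y ≡ u)
      by (inj₁ f) eq = let (p , q) = clash f eq in inj₁ (pos-injective p , pos-injective q)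
      by (inj₂ f) eq = let (p , q) = clash f (sym eq) in inj₂ (pos-injective q , pos-injective p)
    colouring u v (inj₂ e) =
      map₂ (λ clash x y xy eq → swap (clash x y xy eq)) (colouring v u (inj₁ e))

  vertexAt-injective : ∀ σ j {c d} → c < width → d < width → vertexAt σ j c ≡ vertexAt σ j d → c ≡ d
  vertexAt-injective σ j {c} {d} c< d< eq = trans (sym (m<n⇒m%n≡m c<))
    (trans (,-injectiveʳ (,-injectiveʳ
      (trans (sym (pos-vertexAt σ j c)) (trans (cong pos eq) (pos-vertexAt σ j d)))))
    (m<n⇒m%n≡m d<))

  base-cycle : OddCycle tower width
  base-cycle = (λ 2∣ → contradiction (trans (sym (2∣⇒¬odd 2∣)) (cong not L-even)) λ ()) , record
    { length≥3  = s≤s 1<L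
    ; vertex    = λ c → vertexAt 0F 0 (toℕ c)
    ; injective = λ {c} {d} eq → Fin.toℕ-injective
                    (vertexAt-injective 0F 0 (Fin.toℕ<n c) (Fin.toℕ<n d) eq)
    ; step      = λ i j eq →
                    subst (λ d → Adj tower (vertexAt 0F 0 (toℕ i)) (vertexAt 0F 0 d)) (sym eq)
                    (adj-rung 0F (toℕ i) z≤n z≤n flat)
    ; close     = λ i j i≡ j≡ → edge⇒linked (subst₂ Edge
                    (sym (at (toℕ i) (Fin.toℕ<n i))) (sym (at (toℕ j) (Fin.toℕ<n j)))
                    (inj₁ (within (rung z≤n z≤n flat
                      (subst₂ (Next L) (sym (suc-injective i≡)) (sym j≡) wrap)))))
    }
    where
    at : ∀ c → c < width → pos (vertexAt 0F 0 c) ≡ (0F , 0 , c)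
    at c c< = trans (pos-vertexAt 0F 0 c) (cong (λ c → 0F , 0 , c) (m<n⇒m%n≡m c<))

  -- Write the length as 2q + 1. For q at most h + 1 it is at most 2h + 3, hence at most `L`, and no
  -- such closed walk exists; otherwise it is at least 2(h + 2) + 1.
  odd-cycle-long : 2 * h + 3 ≤ L → ∀ m → OddCycle tower m → 2 * h + 5 ≤ m
  odd-cycle-long long zero    (_ , C) with () ← Cycle.length≥3 C
  odd-cycle-long long (suc m) (m-odd , C) with odd m in m-parity
  ... | true  = contradiction (¬odd⇒2∣ (suc m) (cong not m-parity)) m-odd
  ... | false with ¬odd⇒double m m-parity
  ... | q , refl with q ≤? suc h
  ... | no  q≰ = begin
    2 * h + 5                          ≡⟨ lemma h ⟩
    suc (suc (suc h) + suc (suc h))    ≤⟨ s≤s (+-mono-≤ (≰⇒> q≰) (≰⇒> q≰)) ⟩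
    suc (q + q)                        ∎
    where
    open ≤-Reasoning
    lemma : ∀ h → 2 * h + 5 ≡ suc (suc (suc h) + suc (suc h))
    lemma = solve-∀
  ... | yes q≤ with closed-walk tower C
  ... | w , periodic , edges = contradiction (λ t → col-pos (w t))
    (no-short-odd-closed-walk (pos ∘ w) q q≤ (≤-trans bound long)
      (cong pos ∘ periodic) (linked⇒edge ∘ edges))
    where
    lemma : ∀ h → suc (suc h + suc h) ≡ 2 * h + 3
    lemma = solve-∀
    bound : suc (q + q) ≤ 2 * h + 3
    bound = ≤-trans (s≤s (+-mono-≤ q≤ q≤)) (≤-reflexive (lemma h))

  size-tower : width * width < size tower
  size-tower = size-≥ tower f f-injective f∈
    where
    -- One more edge than those between the last rows makes the bound strict.
    f : Fin (suc (width * width)) → Fin n × Fin n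
    f Fin.zero    = vertexAt 0F h 0 , vertexAt 0F (suc h) 0
    f (Fin.suc k) = let (c , d) = remQuot {width} width k
                    in vertexAt 0F (suc h) (toℕ c) , vertexAt 1F (suc h) (toℕ d)

    same-side : ∀ {σ τ j k c d} → vertexAt σ j c ≡ vertexAt τ k d → σ ≡ τ
    same-side {σ} {τ} {j} {k} {c} {d} eq =
      ,-injectiveˡ (trans (sym (pos-vertexAt σ j c)) (trans (cong pos eq) (pos-vertexAt τ k d)))

    f-injective : ∀ {i j} → f i ≡ f j → i ≡ j
    f-injective {Fin.zero}  {Fin.zero}  _  = refl
    f-injective {Fin.zero}  {Fin.suc _} eq = contradiction (same-side (,-injectiveʳ eq)) λ ()
    f-injective {Fin.suc _} {Fin.zero}  eq = contradiction (same-side (,-injectiveʳ eq)) λ ()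
    f-injective {Fin.suc k} {Fin.suc l} eq = cong Fin.suc (trans
      (sym (Fin.combine-remQuot {width} width k))
      (trans (cong₂ combine (columnwise 0F (,-injectiveˡ eq)) (columnwise 1F (,-injectiveʳ eq)))
        (Fin.combine-remQuot {width} width l)))
      where
      columnwise : ∀ σ {c d : Fin width} →
        vertexAt σ (suc h) (toℕ c) ≡ vertexAt σ (suc h) (toℕ d) → c ≡ d
      columnwise σ {c} {d} eq = Fin.toℕ-injective
        (vertexAt-injective σ (suc h) (Fin.toℕ<n c) (Fin.toℕ<n d) eq)

    f∈ : ∀ i → f i ∈ edges tower
    f∈ Fin.zero    = ∈-edges tower (row-< 0F 0 0 ≤-refl ≤-refl) (adj-spoke 0F 0)
    f∈ (Fin.suc k) = let (c , d) = remQuot {width} width k in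
      ∈-edges tower (side-< (suc h) (suc h) (toℕ c) (toℕ d)) (adj-across (toℕ c) (toℕ d))

-- Edge density and the infinite family.

open import Data.Integer using (+_)

denser : ∀ d .{{_ : NonZero d}} G → order G * order G < size G * d → DenserThan (+ 1 / d) G
denser (suc d) G lt = ℚ.toℚᵘ-cancel-< (begin-strict
  ℚ.toℚᵘ (+ 1 / suc d ℚ.* fromℕ N)
    ≃⟨ ℚ.toℚᵘ-homo-* (+ 1 / suc d) (fromℕ N) ⟩
  ℚ.toℚᵘ (+ 1 / suc d) ℚᵘ.* ℚ.toℚᵘ (fromℕ N)
    ≃⟨ ℚᵘ.*-cong (ℚ.toℚᵘ-fromℚᵘ (+ 1 ℚᵘ./ suc d)) (ℚ.toℚᵘ-fromℚᵘ (+ N ℚᵘ./ 1)) ⟩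
  (+ 1 ℚᵘ./ suc d) ℚᵘ.* (+ N ℚᵘ./ 1)
    <⟨ ℚᵘ.*<* numerators ⟩
  + size G ℚᵘ./ 1
    ≃⟨ ℚ.toℚᵘ-fromℚᵘ (+ size G ℚᵘ./ 1) ⟨
  ℚ.toℚᵘ (fromℕ (size G))
    ∎)
  where
  open ℚᵘ.≤-Reasoning
  N = order G * order G

  numerators : (+ 1 ℤ.* + N) ℤ.* + 1 ℤ.< + size G ℤ.* (+ suc d ℤ.* + 1)
  numerators = subst₂ ℤ._<_
    (sym (trans (ℤ.*-identityʳ _) (ℤ.*-identityˡ (+ N))))
    (trans (ℤ.pos-* (size G) (suc d)) (cong (+ size G ℤ.*_) (sym (ℤ.*-identityʳ (+ suc d)))))
    (ℤ.+<+ lt)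

halve : ∀ n → ∃ λ h → n ≤ suc (h + h) × h + h ≤ n
halve zero          = 0 , z≤n , z≤n
halve (suc zero)    = 0 , ≤-refl , z≤n
halve (suc (suc n)) with halve n
... | h , p , q = suc h , s≤s (≤-trans (s≤s p) (≤-reflexive (cong suc (sym (+-suc h h))))) ,
                          s≤s (≤-trans (≤-reflexive (+-suc h h)) (s≤s q))

-- The hypotheses make `h` the integer part of ℓ/2. The first puts the odd girth, at least 2h + 5,
-- above ℓ + 3. The second bounds the 2(h + 2) rows by ℓ + 4: with rows of s vertices there are at
-- most (ℓ + 4)s vertices and more than s² edges.
towers : ∀ ℓ h → ℓ ≤ suc (h + h) → h + h ≤ ℓ → Σ (ℕ → Graph) λ G → PairwiseNonIsomorphic G ×
  (∀ i → Critical 4 (G i) × OddGirthAbove (3 + ℓ) (G i)) ×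
  (∀ i → DenserThan (+ 1 / ((4 + ℓ) * (4 + ℓ))) (G i))
towers ℓ h ℓ≤ ≤ℓ = G , distinct , (λ i → critical-G i , girth i) , λ i → denser _ (G i) (dense i)
  where
  L : ℕ → ℕ
  -- This is even and at least 2h + 4, as `long` requires; it grows with `i`, so the graphs have
  -- different orders.
  L i = (h + 2 + i) + (h + 2 + i)

  even : ∀ i → odd (L i) ≡ false
  even i = odd-+-self (h + 2 + i)

  long : ∀ i → 2 * h + 3 ≤ L i
  long i = ≤-trans (m≤m+n (2 * h + 3) (suc (i + i))) (≤-reflexive (lemma h i))
    where
    lemma : ∀ h i → 2 * h + 3 + suc (i + i) ≡ (h + 2 + i) + (h + 2 + i)
    lemma = solve-∀

  1<L : ∀ i → 1 < L i
  1<L i = ≤-trans (≤-trans (s≤s (s≤s z≤n)) (m≤n+m 3 (2 * h))) (long i)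

  module G i = Tower h (L i) (even i) (1<L i)

  G : ℕ → Graph
  G = G.tower

  critical-G : ∀ i → Critical 4 (G i)
  critical-G = G.tower-critical

  3+ℓ<2h+5 : 3 + ℓ < 2 * h + 5
  3+ℓ<2h+5 = ≤-trans (+-monoʳ-≤ 4 ℓ≤) (≤-reflexive (lemma h))
    where
    lemma : ∀ h → 4 + suc (h + h) ≡ 2 * h + 5
    lemma = solve-∀

  2h+4≤4+ℓ : 2 * suc (suc h) ≤ 4 + ℓ
  2h+4≤4+ℓ = ≤-trans (≤-reflexive (lemma h)) (+-monoʳ-≤ 4 ≤ℓ)
    where
    lemma : ∀ h → 2 * suc (suc h) ≡ 4 + (h + h)
    lemma = solve-∀

  girth : ∀ i → OddGirthAbove (3 + ℓ) (G i)
  girth i = oddGirthAbove (G i) (3 + ℓ) (G.width i , G.base-cycle i)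
    λ m C → ≤-trans 3+ℓ<2h+5 (G.odd-cycle-long i (long i) m C)

  dense : ∀ i → order (G i) * order (G i) < size (G i) * ((4 + ℓ) * (4 + ℓ))
  dense i = begin-strict
    order (G i) * order (G i)                          ≤⟨ *-mono-≤ n≤ n≤ ⟩
    (4 + ℓ) * s * ((4 + ℓ) * s)                        ≡⟨ lemma (4 + ℓ) s ⟩
    (s * s) * ((4 + ℓ) * (4 + ℓ))                      <⟨ *-monoˡ-< ((4 + ℓ) * (4 + ℓ)) (G.size-tower i) ⟩
    size (G i) * ((4 + ℓ) * (4 + ℓ))                   ∎
    where
    open ≤-Reasoning
    s = G.width i
    lemma : ∀ a s → a * s * (a * s) ≡ s * s * (a * a)
    lemma = solve-∀
    n≤ : order (G i) ≤ (4 + ℓ) * s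
    n≤ = ≤-trans (≤-reflexive (sym (*-assoc 2 (suc (suc h)) s))) (*-monoˡ-≤ s 2h+4≤4+ℓ)

  distinct : PairwiseNonIsomorphic G
  distinct i j iso = +-cancelˡ-≡ (h + 2) i j (double-injective (suc-injective
    (*-cancelˡ-≡ (G.width i) (G.width j) (suc (suc h))
      (*-cancelˡ-≡ (suc (suc h) * G.width i) (suc (suc h) * G.width j) 2
        (↔⇒≡ (_≅_.bijection iso))))))
    where
    double-injective : ∀ {m n} → m + m ≡ n + n → m ≡ n
    double-injective {m} {n} eq = *-cancelˡ-≡ m n 2
      (trans (cong (_+_ m) (+-identityʳ m)) (trans eq (cong (_+_ n) (sym (+-identityʳ n)))))

theorem3 : (ℓ : ℕ) → 3 ≤ ℓ →
  (Σ (ℕ → Graph) λ G →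
    PairwiseNonIsomorphic G ×
    (∀ i → Critical 4 (G i) × OddGirthAbove ℓ (G i)) ×
    QuadraticEdgeDensity G)
  × (fromℚ (+ 1 / (suc ℓ * suc ℓ)) ≤ᴸ densityConstant ℓ 4)
theorem3 (suc (suc (suc ℓ))) (s≤s (s≤s (s≤s z≤n))) =
  -- The pattern has lowered `ℓ` by 3, so 4 + ℓ is one more than the original bound. The density
  -- bound being strict, `c` itself is admissible in the supremum.
  let (h , ℓ≤ , ≤ℓ) = halve ℓ
      (G , distinct , good , dense) = towers ℓ h ℓ≤ ≤ℓ
      d = (4 + ℓ) * (4 + ℓ)
      c = + 1 / d
  in (G , distinct , good , c , ℚ.positive⁻¹ c {{ℚ.normalize-pos 1 d}} , dense) ,
     λ q q<c → c , (G , distinct , λ i → proj₁ (good i) , proj₂ (good i) , dense i) , q<c
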